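{- Let $G$ be an incidence hypergraph and $S$ a set. The Frobenius morphism $\Phi_V:\check V^{\diamond}(\check V(G)\times S)\to G\times\check V^{\diamond}(S)$ equals $(\mathrm{id}_{\check V(G)\times S},\mathrm{id}_\emptyset,\mathrm{id}_\emptyset)$ and the Frobenius morphism $\Phi_E:\check E^{\diamond}(\check E(G)\times S)\to G\times\check E^{\diamond}(S)$ equals $(\mathrm{id}_\emptyset,\mathrm{id}_{\check E(G)\times S},\mathrm{id}_\emptyset)$ (components listed as vertex, edge, incidence maps). Moreover, both $(\check V^{\diamond},\check V,\check V^{\star})$ and $(\check E^{\diamond},\check E,\check E^{\star})$ are atomic geometric embeddings from $\mathbf{Set}$ to $\mathfrak{R}$ which are not surjections. Consequently, $\mathbf{Set}$ is equivalent to the slice categories $\mathfrak{R}/\check V^{\diamond}(\{1\})$ and $\mathfrak{R}/\check E^{\diamond}(\{1\})$.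
   Context: An incidence hypergraph $G$ consists of sets $\check V(G)$ (vertices), $\check E(G)$ (edges), $I(G)$ (incidences) and functions $\varsigma_G:I(G)\to\check V(G)$, $\omega_G:I(G)\to\check E(G)$; a morphism is a triple of functions $(\check V(\phi),\check E(\phi),I(\phi))$ with $\varsigma_H\circ I(\phi)=\check V(\phi)\circ\varsigma_G$ and $\omega_H\circ I(\phi)=\check E(\phi)\circ\omega_G$; this is the presheaf topos $\mathfrak{R}$, with products computed componentwise. $\check V,\check E:\mathfrak{R}\to\mathbf{Set}$ are the vertex and edge functors. Their adjoints: $\check V^{\diamond}(X)$ has vertex set $X$ and no edges or incidences; $\check V^{\star}(X)$ has vertices $X$, edges $\{1\}$, incidences $X\times\{1\}$ with the projections; $\check E^{\diamond}(X)$ has edge set $X$ and no vertices or incidences; $\check E^{\star}(X)$ has vertices $\{1\}$, edges $X$, incidences $\{1\}\times X$ with the projections; $\check V^{\diamond}\dashv\check V\dashv\check V^{\star}$ and $\check E^{\diamond}\dashv\check E\dashv\check E^{\star}$. For an adjunction $L\dashv F$ with $F$ preserving products and counit $\varepsilon$, the Frobenius morphism $L(F(A)\times B)\to A\times L(B)$ has components $\varepsilon_A\circ L(\pi_{F(A)})$ and $L(\pi_B)$. A triple $(L,F,F^\star)$ with $L\dashv F\dashv F^\star$, $F:\mathcal{F}\to\mathcal{E}$ between topoi, is an essential geometric morphism $\mathcal{E}\to\mathcal{F}$ with inverse image $F$ and direct image $F^\star$; it is atomic if $F$ is logical (preserves finite limits, exponentials and the subobject classifier; equivalently, the Frobenius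 morphisms are isomorphisms), a surjection if $F$ is faithful, and an embedding if $F^\star$ is full and faithful. -}

module Defs where

open import Level using (Level; suc; _⊔_) renaming (zero to lzero)
open import Data.Empty using (⊥; ⊥-elim)
open import Data.Unit using (⊤; tt)
open import Data.Product using (Σ; Σ-syntax; _×_; _,_; proj₁; proj₂)
open import Relation.Nullary using (¬_)
open import Relation.Binary.PropositionalEquality
  using (_≡_; refl; sym; trans; cong)

record Category (o h e : Level) : Set (suc (o ⊔ h ⊔ e)) where
  infixr 9 _∘_
  infix 4 _≈_
  field
    Obj  : Set o
    Hom  : Obj → Obj → Set h
    _≈_  : ∀ {A B} → Hom A B → Hom A B → Set e
    id   : ∀ {A} → Hom A A
    _∘_  : ∀ {A B C} → Hom B C → Hom A B → Hom A C
    ≈-refl  : ∀ {A B} {f : Hom A B} → f ≈ f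
    ≈-sym   : ∀ {A B} {f g : Hom A B} → f ≈ g → g ≈ f
    ≈-trans : ∀ {A B} {f g k : Hom A B} → f ≈ g → g ≈ k → f ≈ k
    assoc   : ∀ {A B C D} (f : Hom A B) (g : Hom B C) (k : Hom C D) →
              (k ∘ g) ∘ f ≈ k ∘ (g ∘ f)
    identityˡ : ∀ {A B} (f : Hom A B) → id ∘ f ≈ f
    identityʳ : ∀ {A B} (f : Hom A B) → f ∘ id ≈ f
    ∘-resp-≈  : ∀ {A B C} {f f' : Hom A B} {g g' : Hom B C} →
                f ≈ f' → g ≈ g' → g ∘ f ≈ g' ∘ f'

module _ {o₁ h₁ e₁ o₂ h₂ e₂ : Level}
         (C : Category o₁ h₁ e₁) (D : Category o₂ h₂ e₂) where
  private
    module C = Category C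
    module D = Category D

  record Functor : Set (o₁ ⊔ h₁ ⊔ e₁ ⊔ o₂ ⊔ h₂ ⊔ e₂) where
    field
      F₀ : C.Obj → D.Obj
      F₁ : ∀ {A B} → C.Hom A B → D.Hom (F₀ A) (F₀ B)
      identity     : ∀ {A} → F₁ (C.id {A}) D.≈ D.id
      homomorphism : ∀ {A B K} (f : C.Hom A B) (g : C.Hom B K) →
                     F₁ (g C.∘ f) D.≈ F₁ g D.∘ F₁ f
      F-resp-≈     : ∀ {A B} {f g : C.Hom A B} → f C.≈ g → F₁ f D.≈ F₁ g

module _ {o₁ h₁ e₁ o₂ h₂ e₂ : Level}
         {C : Category o₁ h₁ e₁} {D : Category o₂ h₂ e₂} where
  private
    module C = Category C
    module D = Category D

  Faithful : Functor C D → Set (o₁ ⊔ h₁ ⊔ e₁ ⊔ e₂)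
  Faithful F = ∀ {A B} (f g : C.Hom A B) → F₁ f D.≈ F₁ g → f C.≈ g
    where open Functor F

  Full : Functor C D → Set (o₁ ⊔ h₁ ⊔ h₂ ⊔ e₂)
  Full F = ∀ {A B} (g : D.Hom (F₀ A) (F₀ B)) → Σ[ f ∈ C.Hom A B ] F₁ f D.≈ g
    where open Functor F

  record Adjunction (L : Functor C D) (R : Functor D C)
         : Set (o₁ ⊔ h₁ ⊔ e₁ ⊔ o₂ ⊔ h₂ ⊔ e₂) where
    private
      module L = Functor L
      module R = Functor R
    field
      unit   : ∀ X → C.Hom X (R.F₀ (L.F₀ X))
      counit : ∀ A → D.Hom (L.F₀ (R.F₀ A)) A
      unit-natural   : ∀ {X Y} (f : C.Hom X Y) →
                       R.F₁ (L.F₁ f) C.∘ unit X C.≈ unit Y C.∘ f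
      counit-natural : ∀ {A B} (f : D.Hom A B) →
                       f D.∘ counit A D.≈ counit B D.∘ L.F₁ (R.F₁ f)
      triangleˡ : ∀ X → counit (L.F₀ X) D.∘ L.F₁ (unit X) D.≈ D.id
      triangleʳ : ∀ A → R.F₁ (counit A) C.∘ unit (R.F₀ A) C.≈ C.id

  record Equivalence : Set (o₁ ⊔ h₁ ⊔ e₁ ⊔ o₂ ⊔ h₂ ⊔ e₂) where
    field
      F : Functor C D
      G : Functor D C
    private
      module F = Functor F
      module G = Functor G
    field
      α    : ∀ X → C.Hom (G.F₀ (F.F₀ X)) X
      α⁻¹  : ∀ X → C.Hom X (G.F₀ (F.F₀ X))
      α-natural : ∀ {X Y} (f : C.Hom X Y) →
                  α Y C.∘ G.F₁ (F.F₁ f) C.≈ f C.∘ α X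
      α-isoˡ : ∀ X → α⁻¹ X C.∘ α X C.≈ C.id
      α-isoʳ : ∀ X → α X C.∘ α⁻¹ X C.≈ C.id
      β    : ∀ A → D.Hom (F.F₀ (G.F₀ A)) A
      β⁻¹  : ∀ A → D.Hom A (F.F₀ (G.F₀ A))
      β-natural : ∀ {A B} (f : D.Hom A B) →
                  β B D.∘ F.F₁ (G.F₁ f) D.≈ f D.∘ β A
      β-isoˡ : ∀ A → β⁻¹ A D.∘ β A D.≈ D.id
      β-isoʳ : ∀ A → β A D.∘ β⁻¹ A D.≈ D.id

IsIso : ∀ {o h e} (C : Category o h e) {A B : Category.Obj C} →
        Category.Hom C A B → Set (h ⊔ e)
IsIso C {A} {B} f =
  Σ[ g ∈ Hom B A ] ((g ∘ f ≈ id) × (f ∘ g ≈ id))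
  where open Category C

SetCat : Category (suc lzero) lzero lzero
SetCat = record
  { Obj = Set
  ; Hom = λ A B → A → B
  ; _≈_ = λ f g → ∀ x → f x ≡ g x
  ; id = λ x → x
  ; _∘_ = λ g f x → g (f x)
  ; ≈-refl = λ _ → refl
  ; ≈-sym = λ p x → sym (p x)
  ; ≈-trans = λ p q x → trans (p x) (q x)
  ; assoc = λ _ _ _ _ → refl
  ; identityˡ = λ _ _ → refl
  ; identityʳ = λ _ _ → refl
  ; ∘-resp-≈ = λ {_} {_} {_} {f} {f'} {g} {g'} p q x →
                 trans (cong g (p x)) (q (f' x))
  }

record Hyp : Set₁ where
  field
    V : Set
    E : Set
    I : Set
    ς : I → V
    ω : I → E
open Hyp public

record HypHom (G H : Hyp) : Set where
  field
    vmap : V G → V H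
    emap : E G → E H
    imap : I G → I H
    ς-comm : ∀ i → ς H (imap i) ≡ vmap (ς G i)
    ω-comm : ∀ i → ω H (imap i) ≡ emap (ω G i)
open HypHom public

record _≈ᴴ_ {G H : Hyp} (f g : HypHom G H) : Set where
  field
    v≈ : ∀ x → vmap f x ≡ vmap g x
    e≈ : ∀ x → emap f x ≡ emap g x
    i≈ : ∀ x → imap f x ≡ imap g x
open _≈ᴴ_ public

idᴴ : ∀ {G} → HypHom G G
idᴴ = record { vmap = λ x → x ; emap = λ x → x ; imap = λ x → x
             ; ς-comm = λ _ → refl ; ω-comm = λ _ → refl }

_∘ᴴ_ : ∀ {G H K} → HypHom H K → HypHom G H → HypHom G K
g ∘ᴴ f = record
  { vmap = λ x → vmap g (vmap f x)
  ; emap = λ x → emap g (emap f x)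
  ; imap = λ x → imap g (imap f x)
  ; ς-comm = λ i → trans (ς-comm g (imap f i)) (cong (vmap g) (ς-comm f i))
  ; ω-comm = λ i → trans (ω-comm g (imap f i)) (cong (emap g) (ω-comm f i))
  }

private
  resp : ∀ {A B C : Set} {f f' : A → B} {g g' : B → C} →
         (∀ x → f x ≡ f' x) → (∀ x → g x ≡ g' x) →
         ∀ x → g (f x) ≡ g' (f' x)
  resp {f' = f'} {g = g} {g' = g'} p q x = trans (cong g (p x)) (q _)

HypCat : Category (suc lzero) lzero lzero
HypCat = record
  { Obj = Hyp
  ; Hom = HypHom
  ; _≈_ = _≈ᴴ_
  ; id = idᴴ
  ; _∘_ = _∘ᴴ_
  ; ≈-refl = record { v≈ = λ _ → refl ; e≈ = λ _ → refl ; i≈ = λ _ → refl }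
  ; ≈-sym = λ p → record { v≈ = λ x → sym (v≈ p x) ; e≈ = λ x → sym (e≈ p x)
                         ; i≈ = λ x → sym (i≈ p x) }
  ; ≈-trans = λ p q → record { v≈ = λ x → trans (v≈ p x) (v≈ q x)
                             ; e≈ = λ x → trans (e≈ p x) (e≈ q x)
                             ; i≈ = λ x → trans (i≈ p x) (i≈ q x) }
  ; assoc = λ _ _ _ → record { v≈ = λ _ → refl ; e≈ = λ _ → refl ; i≈ = λ _ → refl }
  ; identityˡ = λ _ → record { v≈ = λ _ → refl ; e≈ = λ _ → refl ; i≈ = λ _ → refl }
  ; identityʳ = λ _ → record { v≈ = λ _ → refl ; e≈ = λ _ → refl ; i≈ = λ _ → refl }
  ; ∘-resp-≈ = λ p q → record { v≈ = resp (v≈ p) (v≈ q) ; e≈ = resp (e≈ p) (e≈ q)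
                              ; i≈ = resp (i≈ p) (i≈ q) }
  }

_×ᴴ_ : Hyp → Hyp → Hyp
G ×ᴴ H = record
  { V = V G × V H ; E = E G × E H ; I = I G × I H
  ; ς = λ { (i , j) → ς G i , ς H j }
  ; ω = λ { (i , j) → ω G i , ω H j } }

⟨_,_⟩ᴴ : ∀ {K G H} → HypHom K G → HypHom K H → HypHom K (G ×ᴴ H)
⟨ f , g ⟩ᴴ = record
  { vmap = λ x → vmap f x , vmap g x
  ; emap = λ x → emap f x , emap g x
  ; imap = λ x → imap f x , imap g x
  ; ς-comm = λ i → cong₂' (ς-comm f i) (ς-comm g i)
  ; ω-comm = λ i → cong₂' (ω-comm f i) (ω-comm g i) }
  where
  cong₂' : ∀ {A B : Set} {a a' : A} {b b' : B} → a ≡ a' → b ≡ b' → (a , b) ≡ (a' , b')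
  cong₂' refl refl = refl

Slice : ∀ {o h e} (C : Category o h e) → Category.Obj C → Category (o ⊔ h) (h ⊔ e) e
Slice C X = record
  { Obj = Σ[ A ∈ Obj ] Hom A X
  ; Hom = λ { (A , p) (B , q) → Σ[ f ∈ Hom A B ] (q ∘ f ≈ p) }
  ; _≈_ = λ f g → proj₁ f ≈ proj₁ g
  ; id = λ { {A , p} → id , identityʳ p }
  ; _∘_ = λ { {A , p} {B , q} {K , r} (g , gp) (f , fp) →
              g ∘ f , ≈-trans (≈-sym (assoc f g r))
                        (≈-trans (∘-resp-≈ ≈-refl gp) fp) }
  ; ≈-refl = ≈-refl
  ; ≈-sym = ≈-sym
  ; ≈-trans = ≈-trans
  ; assoc = λ f g k → assoc (proj₁ f) (proj₁ g) (proj₁ k)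
  ; identityˡ = λ f → identityˡ (proj₁ f)
  ; identityʳ = λ f → identityʳ (proj₁ f)
  ; ∘-resp-≈ = ∘-resp-≈
  }
  where open Category C

≈ᴴ-refl : ∀ {G H} {f : HypHom G H} → f ≈ᴴ f
≈ᴴ-refl = record { v≈ = λ _ → refl ; e≈ = λ _ → refl ; i≈ = λ _ → refl }

Vˇ : Functor HypCat SetCat
Vˇ = record { F₀ = V ; F₁ = vmap ; identity = λ _ → refl
            ; homomorphism = λ _ _ _ → refl ; F-resp-≈ = v≈ }

Eˇ : Functor HypCat SetCat
Eˇ = record { F₀ = E ; F₁ = emap ; identity = λ _ → refl
            ; homomorphism = λ _ _ _ → refl ; F-resp-≈ = e≈ }

V⋄₀ : Set → Hyp
V⋄₀ X = record { V = X ; E = ⊥ ; I = ⊥ ; ς = λ () ; ω = λ () }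

V⋄ : Functor SetCat HypCat
V⋄ = record
  { F₀ = V⋄₀
  ; F₁ = λ f → record { vmap = f ; emap = λ () ; imap = λ ()
                      ; ς-comm = λ () ; ω-comm = λ () }
  ; identity = record { v≈ = λ _ → refl ; e≈ = λ () ; i≈ = λ () }
  ; homomorphism = λ _ _ → record { v≈ = λ _ → refl ; e≈ = λ () ; i≈ = λ () }
  ; F-resp-≈ = λ p → record { v≈ = p ; e≈ = λ () ; i≈ = λ () }
  }

V⋆₀ : Set → Hyp
V⋆₀ X = record { V = X ; E = ⊤ ; I = X × ⊤ ; ς = proj₁ ; ω = proj₂ }

V⋆ : Functor SetCat HypCat
V⋆ = record
  { F₀ = V⋆₀
  ; F₁ = λ f → record { vmap = f ; emap = λ x → x
                      ; imap = λ { (x , t) → f x , t }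
                      ; ς-comm = λ _ → refl ; ω-comm = λ _ → refl }
  ; identity = record { v≈ = λ _ → refl ; e≈ = λ _ → refl ; i≈ = λ _ → refl }
  ; homomorphism = λ _ _ → record { v≈ = λ _ → refl ; e≈ = λ _ → refl
                                  ; i≈ = λ _ → refl }
  ; F-resp-≈ = λ p → record { v≈ = p ; e≈ = λ _ → refl
                            ; i≈ = λ { (x , t) → cong (λ y → y , t) (p x) } }
  }

E⋄₀ : Set → Hyp
E⋄₀ X = record { V = ⊥ ; E = X ; I = ⊥ ; ς = λ () ; ω = λ () }

E⋄ : Functor SetCat HypCat
E⋄ = record
  { F₀ = E⋄₀
  ; F₁ = λ f → record { vmap = λ () ; emap = f ; imap = λ ()
                      ; ς-comm = λ () ; ω-comm = λ () }
  ; identity = record { v≈ = λ () ; e≈ = λ _ → refl ; i≈ = λ () }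
  ; homomorphism = λ _ _ → record { v≈ = λ () ; e≈ = λ _ → refl ; i≈ = λ () }
  ; F-resp-≈ = λ p → record { v≈ = λ () ; e≈ = p ; i≈ = λ () }
  }

E⋆₀ : Set → Hyp
E⋆₀ X = record { V = ⊤ ; E = X ; I = ⊤ × X ; ς = proj₁ ; ω = proj₂ }

E⋆ : Functor SetCat HypCat
E⋆ = record
  { F₀ = E⋆₀
  ; F₁ = λ f → record { vmap = λ x → x ; emap = f
                      ; imap = λ { (t , x) → t , f x }
                      ; ς-comm = λ _ → refl ; ω-comm = λ _ → refl }
  ; identity = record { v≈ = λ _ → refl ; e≈ = λ _ → refl ; i≈ = λ _ → refl }
  ; homomorphism = λ _ _ → record { v≈ = λ _ → refl ; e≈ = λ _ → refl
                                  ; i≈ = λ _ → refl }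
  ; F-resp-≈ = λ p → record { v≈ = λ _ → refl ; e≈ = p
                            ; i≈ = λ { (t , x) → cong (λ y → t , y) (p x) } }
  }

εV : ∀ G → HypHom (V⋄₀ (V G)) G
εV G = record { vmap = λ x → x ; emap = λ () ; imap = λ ()
              ; ς-comm = λ () ; ω-comm = λ () }

εE : ∀ G → HypHom (E⋄₀ (E G)) G
εE G = record { vmap = λ () ; emap = λ x → x ; imap = λ ()
              ; ς-comm = λ () ; ω-comm = λ () }

-- Frobenius morphism of L ⊣ F (F : 𝔑 → Set preserves products
-- strictly, F(A) × B being the product in Set), from a counit ε:
--   L(F(A) × B) → A × L(B),  components ε_A ∘ L(π_{F(A)}) and L(π_B)

Frobenius : (L : Functor SetCat HypCat) (F : Functor HypCat SetCat) →
            (ε : ∀ A → HypHom (Functor.F₀ L (Functor.F₀ F A)) A) →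
            ∀ A (B : Set) →
            HypHom (Functor.F₀ L (Functor.F₀ F A × B)) (A ×ᴴ Functor.F₀ L B)
Frobenius L F ε A B = ⟨ ε A ∘ᴴ Functor.F₁ L proj₁ , Functor.F₁ L proj₂ ⟩ᴴ

-- Essential geometric morphisms Set → 𝔑 given by L ⊣ F ⊣ F⋆
-- with F : 𝔑 → Set the inverse image and F⋆ the direct image

record EssentialGeometricMorphism
  (L : Functor SetCat HypCat) (F : Functor HypCat SetCat)
  (F⋆ : Functor SetCat HypCat) : Set₁ where
  field
    L⊣F  : Adjunction L F
    F⊣F⋆ : Adjunction F F⋆

-- atomic: the inverse image F is logical; equivalently (as fixed in the
-- context) every Frobenius morphism of L ⊣ F is an isomorphism
IsAtomic : ∀ {L F F⋆} → EssentialGeometricMorphism L F F⋆ → Set₁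
IsAtomic {L} {F} g = ∀ A (B : Set) →
  IsIso HypCat (Frobenius L F (Adjunction.counit (EssentialGeometricMorphism.L⊣F g)) A B)

IsSurjection : ∀ {L F F⋆} → EssentialGeometricMorphism L F F⋆ → Set₁
IsSurjection {F = F} _ = Faithful F

IsEmbedding : ∀ {L F F⋆} → EssentialGeometricMorphism L F F⋆ → Set₁
IsEmbedding {F⋆ = F⋆} _ = Full F⋆ × Faithful F⋆

module Submission where

-- The vertex functor V̌ and the edge functor Ě of incidence hypergraphs
-- are studied through two dual classes of hypergraphs: the vertex-only
-- ones (no edges, no incidences) and the edge-only ones (no vertices, no
-- incidences).  Morphisms out of a vertex-only hypergraph are exactly its
-- vertex maps, so between vertex-only hypergraphs a morphism is an
-- isomorphism as soon as its vertex map is a bijection; having no edges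
-- and no incidences is reflected along morphisms and inherited by products
-- with a vertex-only factor.
--
-- Everything about V̌ then follows: V̌^⋄(X) is vertex-only, so the Frobenius
-- morphism V̌^⋄(V̌(G) × S) → G × V̌^⋄(S) is the identity on vertices between
-- vertex-only hypergraphs, hence an isomorphism (atomicity); V̌^⋆ is fully
-- faithful; V̌ forgets the edges, hence is not faithful; and every object of
-- 𝔑 / V̌^⋄{1} is vertex-only, hence isomorphic to V̌^⋄ of its vertex set,
-- which gives Set ≃ 𝔑 / V̌^⋄{1}.  The edge side is the same argument with
-- the roles of vertices and edges exchanged.

open import Defs
open import Data.Empty using (⊥-elim)
open import Data.Unit using (⊤; tt)
open import Data.Bool using (Bool; true; false)
open import Data.Product using (Σ-syntax; _×_; _,_; proj₁; proj₂)
open import Relation.Nullary using (¬_)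
open import Relation.Binary.PropositionalEquality using (_≡_; refl; sym; cong)

VertexOnly : Hyp → Set
VertexOnly G = ¬ E G × ¬ I G

EdgeOnly : Hyp → Set
EdgeOnly G = ¬ V G × ¬ I G

V⋄-vertexOnly : ∀ X → VertexOnly (V⋄₀ X)
V⋄-vertexOnly X = (λ ()) , (λ ())

E⋄-edgeOnly : ∀ X → EdgeOnly (E⋄₀ X)
E⋄-edgeOnly X = (λ ()) , (λ ())

vertexOnly-reflect : ∀ {G H} → HypHom G H → VertexOnly H → VertexOnly G
vertexOnly-reflect f (noE , noI) = (λ e → noE (emap f e)) , (λ i → noI (imap f i))

edgeOnly-reflect : ∀ {G H} → HypHom G H → EdgeOnly H → EdgeOnly G
edgeOnly-reflect f (noV , noI) = (λ v → noV (vmap f v)) , (λ i → noI (imap f i))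

×-vertexOnly : ∀ {G H} → VertexOnly H → VertexOnly (G ×ᴴ H)
×-vertexOnly (noE , noI) = (λ e → noE (proj₂ e)) , (λ i → noI (proj₂ i))

×-edgeOnly : ∀ {G H} → EdgeOnly H → EdgeOnly (G ×ᴴ H)
×-edgeOnly (noV , noI) = (λ v → noV (proj₂ v)) , (λ i → noI (proj₂ i))

vertexOnly-hom : ∀ {G H} → VertexOnly G → (V G → V H) → HypHom G H
vertexOnly-hom (noE , noI) f = record
  { vmap = f ; emap = λ e → ⊥-elim (noE e) ; imap = λ i → ⊥-elim (noI i)
  ; ς-comm = λ i → ⊥-elim (noI i) ; ω-comm = λ i → ⊥-elim (noI i) }

vertexOnly-ext : ∀ {G H} → VertexOnly G → {f g : HypHom G H} →
                 (∀ x → vmap f x ≡ vmap g x) → f ≈ᴴ g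
vertexOnly-ext (noE , noI) p =
  record { v≈ = p ; e≈ = λ e → ⊥-elim (noE e) ; i≈ = λ i → ⊥-elim (noI i) }

edgeOnly-hom : ∀ {G H} → EdgeOnly G → (E G → E H) → HypHom G H
edgeOnly-hom (noV , noI) f = record
  { vmap = λ v → ⊥-elim (noV v) ; emap = f ; imap = λ i → ⊥-elim (noI i)
  ; ς-comm = λ i → ⊥-elim (noI i) ; ω-comm = λ i → ⊥-elim (noI i) }

edgeOnly-ext : ∀ {G H} → EdgeOnly G → {f g : HypHom G H} →
               (∀ x → emap f x ≡ emap g x) → f ≈ᴴ g
edgeOnly-ext (noV , noI) p =
  record { v≈ = λ v → ⊥-elim (noV v) ; e≈ = p ; i≈ = λ i → ⊥-elim (noI i) }

vertexOnly-iso : ∀ {G H} → VertexOnly G → VertexOnly H →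
                 (f : HypHom G H) (g : V H → V G) →
                 (∀ x → g (vmap f x) ≡ x) → (∀ y → vmap f (g y) ≡ y) →
                 IsIso HypCat f
vertexOnly-iso oG oH f g gf fg =
  vertexOnly-hom oH g , vertexOnly-ext oG gf , vertexOnly-ext oH fg

edgeOnly-iso : ∀ {G H} → EdgeOnly G → EdgeOnly H →
               (f : HypHom G H) (g : E H → E G) →
               (∀ x → g (emap f x) ≡ x) → (∀ y → emap f (g y) ≡ y) →
               IsIso HypCat f
edgeOnly-iso oG oH f g gf fg =
  edgeOnly-hom oH g , edgeOnly-ext oG gf , edgeOnly-ext oH fg

εV-iso : ∀ {A} → VertexOnly A → IsIso HypCat (εV A)
εV-iso {A} oA = vertexOnly-iso (V⋄-vertexOnly (V A)) oA (εV A) (λ x → x) (λ _ → refl) (λ _ → refl)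

εE-iso : ∀ {A} → EdgeOnly A → IsIso HypCat (εE A)
εE-iso {A} oA = edgeOnly-iso (E⋄-edgeOnly (E A)) oA (εE A) (λ x → x) (λ _ → refl) (λ _ → refl)

-- The Frobenius morphisms act as the identity on vertices (resp. edges):
-- both components of the pairing are projections.
frobeniusV-vertices : ∀ G S (x : V G × S) → vmap (Frobenius V⋄ Vˇ εV G S) x ≡ x
frobeniusV-vertices G S x = refl

frobeniusE-edges : ∀ G S (x : E G × S) → emap (Frobenius E⋄ Eˇ εE G S) x ≡ x
frobeniusE-edges G S x = refl

frobeniusV-iso : ∀ G S → IsIso HypCat (Frobenius V⋄ Vˇ εV G S)
frobeniusV-iso G S =
  vertexOnly-iso (V⋄-vertexOnly (V G × S)) (×-vertexOnly {G} {V⋄₀ S} (V⋄-vertexOnly S)) _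
                 (λ x → x) (λ _ → refl) (frobeniusV-vertices G S)

frobeniusE-iso : ∀ G S → IsIso HypCat (Frobenius E⋄ Eˇ εE G S)
frobeniusE-iso G S =
  edgeOnly-iso (E⋄-edgeOnly (E G × S)) (×-edgeOnly {G} {E⋄₀ S} (E⋄-edgeOnly S)) _
               (λ x → x) (λ _ → refl) (frobeniusE-edges G S)

V⋄⊣V : Adjunction V⋄ Vˇ
V⋄⊣V = record
  { unit = λ X x → x
  ; counit = εV
  ; unit-natural = λ f x → refl
  ; counit-natural = λ {A} f → vertexOnly-ext (V⋄-vertexOnly (V A)) (λ _ → refl)
  ; triangleˡ = λ X → vertexOnly-ext (V⋄-vertexOnly X) (λ _ → refl)
  ; triangleʳ = λ A x → refl }

E⋄⊣E : Adjunction E⋄ Eˇ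
E⋄⊣E = record
  { unit = λ X x → x
  ; counit = εE
  ; unit-natural = λ f x → refl
  ; counit-natural = λ {A} f → edgeOnly-ext (E⋄-edgeOnly (E A)) (λ _ → refl)
  ; triangleˡ = λ X → edgeOnly-ext (E⋄-edgeOnly X) (λ _ → refl)
  ; triangleʳ = λ A x → refl }

unitV⋆ : ∀ G → HypHom G (V⋆₀ (V G))
unitV⋆ G = record { vmap = λ x → x ; emap = λ _ → tt ; imap = λ i → ς G i , tt
                  ; ς-comm = λ _ → refl ; ω-comm = λ _ → refl }

V⊣V⋆ : Adjunction Vˇ V⋆
V⊣V⋆ = record
  { unit = unitV⋆
  ; counit = λ X x → x
  ; unit-natural = λ f → record
      { v≈ = λ _ → refl ; e≈ = λ _ → refl
      ; i≈ = λ i → cong (λ y → y , tt) (sym (ς-comm f i)) }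
  ; counit-natural = λ f x → refl
  ; triangleˡ = λ G x → refl
  ; triangleʳ = λ X → ≈ᴴ-refl }

unitE⋆ : ∀ G → HypHom G (E⋆₀ (E G))
unitE⋆ G = record { vmap = λ _ → tt ; emap = λ x → x ; imap = λ i → tt , ω G i
                  ; ς-comm = λ _ → refl ; ω-comm = λ _ → refl }

E⊣E⋆ : Adjunction Eˇ E⋆
E⊣E⋆ = record
  { unit = unitE⋆
  ; counit = λ X x → x
  ; unit-natural = λ f → record
      { v≈ = λ _ → refl ; e≈ = λ _ → refl
      ; i≈ = λ i → cong (λ y → tt , y) (sym (ω-comm f i)) }
  ; counit-natural = λ f x → refl
  ; triangleˡ = λ G x → refl
  ; triangleʳ = λ X → ≈ᴴ-refl }

-- V̌^⋆ is fully faithful: a morphism V̌^⋆(X) → V̌^⋆(Y) is determined by its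
-- vertex map, the edge map landing in {1} and ς-commutation fixing the
-- incidence map.
V⋆-full : Full V⋆
V⋆-full g = vmap g , record
  { v≈ = λ _ → refl ; e≈ = λ _ → refl
  ; i≈ = λ { (x , t) → cong (λ y → y , t) (sym (ς-comm g (x , t))) } }

V⋆-faithful : Faithful V⋆
V⋆-faithful f g p = v≈ p

E⋆-full : Full E⋆
E⋆-full g = emap g , record
  { v≈ = λ _ → refl ; e≈ = λ _ → refl
  ; i≈ = λ { (t , x) → cong (λ y → t , y) (sym (ω-comm g (t , x))) } }

E⋆-faithful : Faithful E⋆
E⋆-faithful f g p = e≈ p

-- V̌ is not faithful: the two maps Ě^⋄{1} → Ě^⋄(Bool) picking different
-- edges have the same (empty) vertex map.  Dually for Ě.
Vˇ-not-faithful : ¬ Faithful Vˇ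
Vˇ-not-faithful faithful = true≢false (e≈ (faithful pickTrue pickFalse (λ ())) tt)
  where
  pickTrue pickFalse : HypHom (E⋄₀ ⊤) (E⋄₀ Bool)
  pickTrue  = Functor.F₁ E⋄ (λ _ → true)
  pickFalse = Functor.F₁ E⋄ (λ _ → false)
  true≢false : ¬ true ≡ false
  true≢false ()

Eˇ-not-faithful : ¬ Faithful Eˇ
Eˇ-not-faithful faithful = true≢false (v≈ (faithful pickTrue pickFalse (λ ())) tt)
  where
  pickTrue pickFalse : HypHom (V⋄₀ ⊤) (V⋄₀ Bool)
  pickTrue  = Functor.F₁ V⋄ (λ _ → true)
  pickFalse = Functor.F₁ V⋄ (λ _ → false)
  true≢false : ¬ true ≡ false
  true≢false ()

vertexMorphism : EssentialGeometricMorphism V⋄ Vˇ V⋆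
vertexMorphism = record { L⊣F = V⋄⊣V ; F⊣F⋆ = V⊣V⋆ }

edgeMorphism : EssentialGeometricMorphism E⋄ Eˇ E⋆
edgeMorphism = record { L⊣F = E⋄⊣E ; F⊣F⋆ = E⊣E⋆ }

-- The round trip on Set is the identity; on the slice, an
-- object (A , p) is vertex-only because p points into V̌^⋄{1}, so the counit
-- ε_A is an isomorphism V̌^⋄(V̌ A) ≅ A over V̌^⋄{1}.
sliceV-equivalence : Equivalence {C = SetCat} {D = Slice HypCat (V⋄₀ ⊤)}
sliceV-equivalence = record
  { F = record
      { F₀ = λ X → V⋄₀ X , Functor.F₁ V⋄ (λ _ → tt)
      ; F₁ = λ {X} f → Functor.F₁ V⋄ f , discrete X (λ _ → refl)
      ; identity = λ {X} → discrete X (λ _ → refl)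
      ; homomorphism = λ {X} _ _ → discrete X (λ _ → refl)
      ; F-resp-≈ = λ {X} p → discrete X p }
  ; G = record
      { F₀ = λ A → V (proj₁ A)
      ; F₁ = λ f → vmap (proj₁ f)
      ; identity = λ _ → refl
      ; homomorphism = λ _ _ _ → refl
      ; F-resp-≈ = v≈ }
  ; α = λ X x → x
  ; α⁻¹ = λ X x → x
  ; α-natural = λ f x → refl
  ; α-isoˡ = λ X x → refl
  ; α-isoʳ = λ X x → refl
  ; β = λ { (A , p) → εV A , discrete (V A) (λ _ → refl) }
  ; β⁻¹ = λ { (A , p) → proj₁ (counit-iso p) , vertexOnly-ext (overPoint p) (λ _ → refl) }
  ; β-natural = λ { {A , _} f → discrete (V A) (λ _ → refl) }
  ; β-isoˡ = λ { (A , p) → proj₁ (proj₂ (counit-iso p)) }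
  ; β-isoʳ = λ { (A , p) → proj₂ (proj₂ (counit-iso p)) } }
  where
  discrete : ∀ X {H} {f g : HypHom (V⋄₀ X) H} → (∀ x → vmap f x ≡ vmap g x) → f ≈ᴴ g
  discrete X = vertexOnly-ext (V⋄-vertexOnly X)

  overPoint : ∀ {A} → HypHom A (V⋄₀ ⊤) → VertexOnly A
  overPoint p = vertexOnly-reflect p (V⋄-vertexOnly ⊤)

  counit-iso : ∀ {A} → HypHom A (V⋄₀ ⊤) → IsIso HypCat (εV A)
  counit-iso p = εV-iso (overPoint p)

sliceE-equivalence : Equivalence {C = SetCat} {D = Slice HypCat (E⋄₀ ⊤)}
sliceE-equivalence = record
  { F = record
      { F₀ = λ X → E⋄₀ X , Functor.F₁ E⋄ (λ _ → tt)
      ; F₁ = λ {X} f → Functor.F₁ E⋄ f , discrete X (λ _ → refl)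
      ; identity = λ {X} → discrete X (λ _ → refl)
      ; homomorphism = λ {X} _ _ → discrete X (λ _ → refl)
      ; F-resp-≈ = λ {X} p → discrete X p }
  ; G = record
      { F₀ = λ A → E (proj₁ A)
      ; F₁ = λ f → emap (proj₁ f)
      ; identity = λ _ → refl
      ; homomorphism = λ _ _ _ → refl
      ; F-resp-≈ = e≈ }
  ; α = λ X x → x
  ; α⁻¹ = λ X x → x
  ; α-natural = λ f x → refl
  ; α-isoˡ = λ X x → refl
  ; α-isoʳ = λ X x → refl
  ; β = λ { (A , p) → εE A , discrete (E A) (λ _ → refl) }
  ; β⁻¹ = λ { (A , p) → proj₁ (counit-iso p) , edgeOnly-ext (overPoint p) (λ _ → refl) }
  ; β-natural = λ { {A , _} f → discrete (E A) (λ _ → refl) }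
  ; β-isoˡ = λ { (A , p) → proj₁ (proj₂ (counit-iso p)) }
  ; β-isoʳ = λ { (A , p) → proj₂ (proj₂ (counit-iso p)) } }
  where
  discrete : ∀ X {H} {f g : HypHom (E⋄₀ X) H} → (∀ x → emap f x ≡ emap g x) → f ≈ᴴ g
  discrete X = edgeOnly-ext (E⋄-edgeOnly X)

  overPoint : ∀ {A} → HypHom A (E⋄₀ ⊤) → EdgeOnly A
  overPoint p = edgeOnly-reflect p (E⋄-edgeOnly ⊤)

  counit-iso : ∀ {A} → HypHom A (E⋄₀ ⊤) → IsIso HypCat (εE A)
  counit-iso p = εE-iso (overPoint p)

mainTheorem15 :
    ((G : Hyp) (S : Set) →
       ((x : V G × S) → vmap (Frobenius V⋄ Vˇ εV G S) x ≡ x)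
       × ¬ E (G ×ᴴ V⋄₀ S) × ¬ I (G ×ᴴ V⋄₀ S))
    × ((G : Hyp) (S : Set) →
       ((x : E G × S) → emap (Frobenius E⋄ Eˇ εE G S) x ≡ x)
       × ¬ V (G ×ᴴ E⋄₀ S) × ¬ I (G ×ᴴ E⋄₀ S))
    × (Σ[ g ∈ EssentialGeometricMorphism V⋄ Vˇ V⋆ ]
         (IsAtomic g × IsEmbedding g × ¬ IsSurjection g))
    × (Σ[ g ∈ EssentialGeometricMorphism E⋄ Eˇ E⋆ ]
         (IsAtomic g × IsEmbedding g × ¬ IsSurjection g))
    × Equivalence {C = SetCat} {D = Slice HypCat (V⋄₀ ⊤)}
    × Equivalence {C = SetCat} {D = Slice HypCat (E⋄₀ ⊤)}
mainTheorem15 =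
    (λ G S → frobeniusV-vertices G S , ×-vertexOnly {G} {V⋄₀ S} (V⋄-vertexOnly S))
  , (λ G S → frobeniusE-edges G S , ×-edgeOnly {G} {E⋄₀ S} (E⋄-edgeOnly S))
  , (vertexMorphism , frobeniusV-iso , (V⋆-full , V⋆-faithful) , Vˇ-not-faithful)
  , (edgeMorphism , frobeniusE-iso , (E⋆-full , E⋆-faithful) , Eˇ-not-faithful)
  , sliceV-equivalence
  , sliceE-equivalence
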